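{- For every graph $G$, $\mathrm{scw}(G) \le \mathrm{cw}(G) \le 2\,\mathrm{scw}(G)$, where $\mathrm{cw}(G)$ denotes the clique-width and $\mathrm{scw}(G)$ the slick clique-width of $G$.
   Context: Graphs are finite, simple, undirected, with at least one vertex. For a positive integer $k$ let $[k]=\{1,\dots,k\}$. A labeled graph (with labels in $[k]$) is a graph in which each vertex is assigned exactly one label in $[k]$. A $k$-expression is an expression formed from atoms $i(v)$, unary operations $\eta_{i,j}$ and $\rho_{i\to j}$, and a binary operation $\oplus$, with $i,j\in[k]$, where: $i(v)$ creates a single vertex $v$ with label $i$; $\eta_{i,j}$ (for $i\ne j$) adds all edges not already present between every vertex with label $i$ and every vertex with label $j$; $\rho_{i\to j}$ changes all labels $i$ to $j$; $\oplus$ forms the disjoint union of two labeled graphs. The graph generated by a $k$-expression is obtained by deleting the labels. The clique-width $\mathrm{cw}(G)$ is the smallest $k$ such that $G$ is generated by a $k$-expression. A slick $k$-expression is an expression formed from atoms $i(v)$ (with $i\in[k]$, creating a single vertex $v$ with label $i$) and binary operations $\oplus_{S,L,R}$, where $L,R$ are functions $[k]\to[k]$ and $S\subseteq[k]\times[k]$. For labeled graphs $G,H$ with labels in $[k]$, $G\oplus_{S,L,R}H$ is obtained as follows: take the disjoint union of $G$ and $H$; add edges from every vertex labeled $i$ in $G$ to every vertex labeled $j$ in $H$ for all $(i,j)\in S$; afterwards replace every label $i$ of a vertex of $G$ by $L(i)$ and every label $i$ of a vertex of $H$ by $R(i)$. The graph generated by a slick $k$-expression is obtained by deleting the labels. The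 slick clique-width $\mathrm{scw}(G)$ is the smallest $k$ such that $G$ is generated by a slick $k$-expression. -}

module Defs where

open import Data.Bool using (Bool; false; T; if_then_else_)
open import Data.Bool.Properties using (T?)
open import Data.Empty using (⊥)
open import Data.Fin using (Fin; _≟_)
open import Data.Fin.Properties using (+↔⊎)
open import Data.Nat using (ℕ; suc; _+_; _≤_; NonZero)
open import Data.Product using (∃-syntax; _×_; _,_)
open import Data.Sum using (_⊎_; inj₁; inj₂; [_,_])
open import Data.Sum.Function.Propositional using (_⊎-↔_)
open import Function using (_∘_; _↔_; _⇔_; Inverse)
open import Function.Construct.Composition using (_↔-∘_)
open import Function.Construct.Identity using (↔-id)
open import Function.Construct.Symmetry using (↔-sym)
open import Relation.Binary.PropositionalEquality using (_≡_; _≢_; sym; trans)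
open import Relation.Nullary using (¬_; Dec; no; does)
open import Relation.Nullary.Decidable using (_×-dec_; _⊎-dec_)

private
  variable
    k : ℕ

-- Adjacency is required to be decidable, as it is classically on a finite
-- vertex set.
record Graph : Set₁ where
  field
    Vertex    : Set
    order     : ℕ
    nonEmpty  : NonZero order
    enumerate : Vertex ↔ Fin order
    Adj       : Vertex → Vertex → Set
    adj?      : ∀ u v → Dec (Adj u v)
    adj-sym   : ∀ {u v} → Adj u v → Adj v u
    adj-irr   : ∀ {v} → ¬ Adj v v

record _≅_ (G H : Graph) : Set where
  private
    module G = Graph G
    module H = Graph H
  field
    bijection : G.Vertex ↔ H.Vertex
  open Inverse bijection using (to)
  field
    preserves : ∀ u v → G.Adj u v ⇔ H.Adj (to u) (to v)

-- Labels in [k] are elements of Fin k.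
record LabelledGraph (k : ℕ) : Set₁ where
  field
    graph : Graph
  open Graph graph public
  field
    label : Vertex → Fin k

open LabelledGraph using (graph)

singleVertex : Fin k → LabelledGraph k
singleVertex i = record
  { graph = record
    { Vertex    = Fin 1
    ; order     = 1
    ; nonEmpty  = _
    ; enumerate = ↔-id (Fin 1)
    ; Adj       = λ _ _ → ⊥
    ; adj?      = λ _ _ → no λ ()
    ; adj-sym   = λ ()
    ; adj-irr   = λ ()
    }
  ; label = λ _ → i
  }

addEdges : (i j : Fin k) → i ≢ j → LabelledGraph k → LabelledGraph k
addEdges i j i≢j G = record
  { graph = record
    { Vertex    = Vertex
    ; order     = order
    ; nonEmpty  = nonEmpty
    ; enumerate = enumerate
    ; Adj       = λ u v → Adj u v ⊎ (Between u v ⊎ Between v u)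
    ; adj?      = λ u v → adj? u v ⊎-dec (between? u v ⊎-dec between? v u)
    ; adj-sym   = λ { (inj₁ a)        → inj₁ (adj-sym a)
                    ; (inj₂ (inj₁ b)) → inj₂ (inj₂ b)
                    ; (inj₂ (inj₂ b)) → inj₂ (inj₁ b)
                    }
    ; adj-irr   = [ adj-irr , [ between-irr , between-irr ] ]
    }
  ; label = label
  }
  where
  open LabelledGraph G

  Between : Vertex → Vertex → Set
  Between u v = label u ≡ i × label v ≡ j

  between? : ∀ u v → Dec (Between u v)
  between? u v = (label u ≟ i) ×-dec (label v ≟ j)

  between-irr : ∀ {v} → ¬ Between v v
  between-irr (p , q) = i≢j (trans (sym p) q)

mapLabels : (Fin k → Fin k) → LabelledGraph k → LabelledGraph k
mapLabels f G = record { graph = graph G ; label = f ∘ LabelledGraph.label G }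

rename : (i j : Fin k) → Fin k → Fin k
rename i j l = if does (l ≟ i) then j else l

-- Disjoint union of G and H, plus an edge between u in G and v in H whenever
-- (label u , label v) lies in S; labels are kept.
join : (S : Fin k → Fin k → Bool) → (G H : LabelledGraph k) → LabelledGraph k
join S G H = record
  { graph = record
    { Vertex    = G.Vertex ⊎ H.Vertex
    ; order     = G.order + H.order
    ; nonEmpty  = +-nonZero G.nonEmpty
    ; enumerate = ↔-sym +↔⊎ ↔-∘ (G.enumerate ⊎-↔ H.enumerate)
    ; Adj       = JoinAdj
    ; adj?      = joinAdj?
    ; adj-sym   = λ {u} {v} → joinAdj-sym u v
    ; adj-irr   = λ {v} → joinAdj-irr v
    }
  ; label = [ G.label , H.label ]
  }
  where
  module G = LabelledGraph G
  module H = LabelledGraph H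

  +-nonZero : ∀ {m n} → NonZero m → NonZero (m + n)
  +-nonZero {suc _} _ = _

  JoinAdj : G.Vertex ⊎ H.Vertex → G.Vertex ⊎ H.Vertex → Set
  JoinAdj (inj₁ u) (inj₁ v) = G.Adj u v
  JoinAdj (inj₁ u) (inj₂ v) = T (S (G.label u) (H.label v))
  JoinAdj (inj₂ u) (inj₁ v) = T (S (G.label v) (H.label u))
  JoinAdj (inj₂ u) (inj₂ v) = H.Adj u v

  joinAdj? : ∀ u v → Dec (JoinAdj u v)
  joinAdj? (inj₁ u) (inj₁ v) = G.adj? u v
  joinAdj? (inj₁ u) (inj₂ v) = T? _
  joinAdj? (inj₂ u) (inj₁ v) = T? _
  joinAdj? (inj₂ u) (inj₂ v) = H.adj? u v

  joinAdj-sym : ∀ u v → JoinAdj u v → JoinAdj v u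
  joinAdj-sym (inj₁ u) (inj₁ v) = G.adj-sym
  joinAdj-sym (inj₁ u) (inj₂ v) a = a
  joinAdj-sym (inj₂ u) (inj₁ v) a = a
  joinAdj-sym (inj₂ u) (inj₂ v) = H.adj-sym

  joinAdj-irr : ∀ v → ¬ JoinAdj v v
  joinAdj-irr (inj₁ v) = G.adj-irr
  joinAdj-irr (inj₂ v) = H.adj-irr

disjointUnion : (G H : LabelledGraph k) → LabelledGraph k
disjointUnion = join (λ _ _ → false)

slickJoin : (S : Fin k → Fin k → Bool) (L R : Fin k → Fin k) →
            (G H : LabelledGraph k) → LabelledGraph k
slickJoin S L R G H = record
  { graph = graph (join S G H)
  ; label = [ L ∘ LabelledGraph.label G , R ∘ LabelledGraph.label H ]
  }

-- Atoms carry no vertex name: each occurrence of an atom creates a fresh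
-- vertex, and graphs are generated up to isomorphism.
data Expr (k : ℕ) : Set where
  atom : (i : Fin k) → Expr k
  η    : (i j : Fin k) → i ≢ j → Expr k → Expr k
  ρ    : (i j : Fin k) → Expr k → Expr k
  _⊕_  : Expr k → Expr k → Expr k

⟦_⟧ : Expr k → LabelledGraph k
⟦ atom i ⟧      = singleVertex i
⟦ η i j i≢j e ⟧ = addEdges i j i≢j ⟦ e ⟧
⟦ ρ i j e ⟧     = mapLabels (rename i j) ⟦ e ⟧
⟦ e ⊕ f ⟧       = disjointUnion ⟦ e ⟧ ⟦ f ⟧

data SlickExpr (k : ℕ) : Set where
  atom    : (i : Fin k) → SlickExpr k
  ⊕[_,_,_] : (S : Fin k → Fin k → Bool) (L R : Fin k → Fin k) →
             SlickExpr k → SlickExpr k → SlickExpr k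

⟦_⟧ˢ : SlickExpr k → LabelledGraph k
⟦ atom i ⟧ˢ              = singleVertex i
⟦ ⊕[ S , L , R ] e f ⟧ˢ = slickJoin S L R ⟦ e ⟧ˢ ⟦ f ⟧ˢ

GeneratedBy : Graph → ℕ → Set
GeneratedBy G k = ∃[ e ] graph (⟦_⟧ {k} e) ≅ G

SlickGeneratedBy : Graph → ℕ → Set
SlickGeneratedBy G k = ∃[ e ] graph (⟦_⟧ˢ {k} e) ≅ G

IsLeast : (ℕ → Set) → ℕ → Set
IsLeast P k = P k × (∀ m → P m → k ≤ m)

-- There are no expressions over zero labels, so the least k is positive.
IsCliqueWidth : Graph → ℕ → Set
IsCliqueWidth G = IsLeast (GeneratedBy G)

IsSlickCliqueWidth : Graph → ℕ → Set
IsSlickCliqueWidth G = IsLeast (SlickGeneratedBy G)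

{-# OPTIONS --safe #-}

-- For scw ≤ cw, edges that some η will add later are postponed: an expression
-- is translated together with the set of pairs of labels still to be connected,
-- η enlarges that set, ρ pulls it back, and ⊕ realises the part of it that
-- crosses the two sides.  For cw ≤ 2 scw, a slick join keeps the labels of one
-- side in [k], moves those of the other to a second copy of [k], and adds the
-- edges one pair of labels at a time.  The simultaneous relabelling that remains
-- may permute labels, which no sequence of ρ's does; but an injective relabelling
-- can be applied to the whole expression from the inside, and every self-map of
-- the labels is a composite of injective ones and ρ's.

module Submission where

open import Defs
open import Data.Bool using (Bool; T; false)
open import Data.Bool.Properties using (T?)
open import Data.Empty using (⊥)
open import Data.Fin using (Fin; toℕ; fromℕ<; _↑ˡ_; _↑ʳ_; splitAt; _≟_)
open import Data.Fin.Properties using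
  ( any?; ¬∀⟶∃¬; injective⇒≤; toℕ<n; toℕ-fromℕ<; toℕ-injective; fromℕ<-injective
  ; ↑ˡ-injective; ↑ʳ-injective; splitAt-↑ˡ; splitAt-↑ʳ )
open import Data.List using (List; []; _∷_; filter; cartesianProduct; allFin)
open import Data.List.Membership.Propositional using (_∈_)
open import Data.List.Membership.Propositional.Properties using
  (∈-filter⁺; ∈-filter⁻; ∈-cartesianProduct⁺; ∈-allFin)
open import Data.List.Relation.Unary.Any using (here; there)
open import Data.Nat using (ℕ; zero; suc; _+_; _≤_; _<_; _*_; _<?_; s≤s)
open import Data.Nat.Properties using
  (+-suc; +-identityʳ; m≤n+m; <-irrefl; <⇒≱; m<1+n⇒m<n∨m≡n)
open import Data.Product using (∃-syntax; _×_; _,_; proj₁; proj₂)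
open import Data.Sum using (_⊎_; inj₁; inj₂; [_,_]; swap)
open import Data.Sum.Function.Propositional using (_⊎-↔_; _⊎-⇔_)
open import Data.Vec.Functional using (updateAt)
open import Data.Vec.Functional.Properties using (updateAt-updates; updateAt-minimal)
open import Function using (_∘_; id; const; _↔_; _⇔_; mk⇔; Inverse; Equivalence; Injective)
open import Function.Construct.Composition using (_↔-∘_; _⇔-∘_)
open import Function.Construct.Identity using (↔-id; ⇔-id)
open import Relation.Binary.PropositionalEquality using
  (_≡_; _≢_; _≗_; refl; sym; trans; cong; subst; subst₂; module ≡-Reasoning)
open import Relation.Nullary using (¬_; Dec; yes; no; contradiction)
open import Relation.Nullary.Decidable using
  (_×-dec_; _⊎-dec_; ⌊_⌋; toWitness; fromWitness)

open LabelledGraph using (graph)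

-- Presentations of labelled graphs on a given vertex set

private
  variable
    k m n : ℕ
    V W : Set

-- The target is a bare relation with a labelling rather than a `LabelledGraph`, so that
-- intermediate relations, such as an adjacency together with postponed edges, need no proofs of
-- decidability, symmetry or irreflexivity.
record Realises (G : LabelledGraph k) (_~_ : V → V → Set) (lab : V → Fin k) : Set where
  private module G = LabelledGraph G
  field
    bijection : G.Vertex ↔ V
  open Inverse bijection public using (to)
  field
    preserves : ∀ u v → G.Adj u v ⇔ (to u ~ to v)
    labels    : ∀ u → G.label u ≡ lab (to u)

private
  variable
    G H : LabelledGraph k
    _~_ _~₁_ _~₂_ : V → V → Set
    lab lab₁ lab₂ : V → Fin k

realises-self : Realises G (LabelledGraph.Adj G) (LabelledGraph.label G)
realises-self = record
  { bijection = ↔-id _ ; preserves = λ _ _ → ⇔-id _ ; labels = λ _ → refl }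

realises-resp : (∀ u v → (u ~₁ v) ⇔ (u ~₂ v)) → lab₁ ≗ lab₂ →
                Realises G _~₁_ lab₁ → Realises G _~₂_ lab₂
realises-resp adj lab r = record
  { bijection = bijection
  ; preserves = λ u v → adj _ _ ⇔-∘ preserves u v
  ; labels    = λ u → trans (labels u) (lab _)
  }
  where open Realises r

realises-trans : (f : Fin n → Fin k) →
                 Realises G (LabelledGraph.Adj H) (f ∘ LabelledGraph.label H) →
                 Realises H _~_ lab → Realises G _~_ (f ∘ lab)
realises-trans f r s = record
  { bijection = S.bijection ↔-∘ R.bijection
  ; preserves = λ u v → S.preserves _ _ ⇔-∘ R.preserves u v
  ; labels    = λ u → trans (R.labels u) (cong f (S.labels _))
  }
  where
  module R = Realises r
  module S = Realises s

realises-mapLabels : (f : Fin k → Fin k) →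
                     Realises G _~_ lab → Realises (mapLabels f G) _~_ (f ∘ lab)
realises-mapLabels f r = record
  { bijection = bijection ; preserves = preserves ; labels = cong f ∘ labels }
  where open Realises r

realises⇒≅ : ∀ {K : Graph} → Realises G (Graph.Adj (graph H)) lab →
             graph H ≅ K → graph G ≅ K
realises⇒≅ r i = record
  { bijection = _≅_.bijection i ↔-∘ bijection
  ; preserves = λ u v → _≅_.preserves i _ _ ⇔-∘ preserves u v
  }
  where open Realises r

-- The order inside the second disjunct follows `addEdges`, whose new edges are thus instances of
-- `Connects` by definition.
Connects : (i j a b : Fin k) → Set
Connects i j a b = (a ≡ i × b ≡ j) ⊎ (b ≡ i × a ≡ j)

connects? : (i j a b : Fin k) → Dec (Connects i j a b)
connects? i j a b = ((a ≟ i) ×-dec (b ≟ j)) ⊎-dec ((b ≟ i) ×-dec (a ≟ j))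

realises-addEdges : {i j : Fin k} (i≢j : i ≢ j) → Realises G _~_ lab →
  Realises (addEdges i j i≢j G) (λ u v → (u ~ v) ⊎ Connects i j (lab u) (lab v)) lab
realises-addEdges {G = G} {lab = lab} {i = i} {j} i≢j r = record
  { bijection = bijection
  ; preserves = λ u v → preserves u v ⊎-⇔ connects u v
  ; labels    = labels
  }
  where
  open Realises r
  open LabelledGraph G using (label)

  connects : ∀ u v → Connects i j (label u) (label v) ⇔
                     Connects i j (lab (to u)) (lab (to v))
  connects u v rewrite labels u | labels v = ⇔-id _

JoinRel : (V → V → Set) → (V → W → Set) → (W → W → Set) → V ⊎ W → V ⊎ W → Set
JoinRel A C B (inj₁ u) (inj₁ v) = A u v
JoinRel A C B (inj₁ u) (inj₂ v) = C u v
JoinRel A C B (inj₂ u) (inj₁ v) = C v u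
JoinRel A C B (inj₂ u) (inj₂ v) = B u v

realises-slickJoin : ∀ S (L R : Fin k → Fin k) →
  Realises G _~₁_ lab₁ → Realises H _~₂_ lab₂ →
  Realises (slickJoin S L R G H)
           (JoinRel _~₁_ (λ u v → T (S (lab₁ u) (lab₂ v))) _~₂_)
           [ L ∘ lab₁ , R ∘ lab₂ ]
realises-slickJoin {G = G} {lab₁ = lab₁} {H = H} {lab₂ = lab₂} S L R r s = record
  { bijection = R.bijection ⊎-↔ S.bijection
  ; preserves = λ
    { (inj₁ u) (inj₁ v) → R.preserves u v
    ; (inj₁ u) (inj₂ v) → crossing u v
    ; (inj₂ u) (inj₁ v) → crossing v u
    ; (inj₂ u) (inj₂ v) → S.preserves u v
    }
  ; labels = [ cong L ∘ R.labels , cong R ∘ S.labels ]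
  }
  where
  module R = Realises r
  module S = Realises s
  module G = LabelledGraph G
  module H = LabelledGraph H

  crossing : ∀ u v → T (S (G.label u) (H.label v)) ⇔
                     T (S (lab₁ (R.to u)) (lab₂ (S.to v)))
  crossing u v rewrite R.labels u | S.labels v = ⇔-id _

-- From expressions to slick expressions

-- Induction on `e`, with two kinds of work pending: `∼` holds the label pairs still to be
-- connected, `f` the relabelling still to be carried out. Both refer to the labels that `e` itself
-- produces. Irreflexivity of `∼` is what keeps an atom free of loops.
slicken : (e : Expr k) {_∼_ : Fin k → Fin k → Set} (_∼?_ : ∀ a b → Dec (a ∼ b)) →
          (∀ {a b} → a ∼ b → b ∼ a) → (∀ {a} → ¬ a ∼ a) → (f : Fin k → Fin k) →
          let open LabelledGraph ⟦ e ⟧ in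
          ∃[ e′ ] Realises ⟦ e′ ⟧ˢ (λ u v → Adj u v ⊎ (label u ∼ label v)) (f ∘ label)
slicken (atom i) _ _ irr f = atom (f i) , record
  { bijection = ↔-id _
  ; preserves = λ _ _ → mk⇔ (λ ()) [ id , irr ]
  ; labels    = λ _ → refl
  }
slicken (η i j i≢j e) {_∼_} _∼?_ ∼-sym irr f
  with e′ , r ← slicken e
         {λ a b → a ∼ b ⊎ Connects i j a b}
         (λ a b → (a ∼? b) ⊎-dec connects? i j a b)
         (λ { (inj₁ p) → inj₁ (∼-sym p)
            ; (inj₂ (inj₁ p)) → inj₂ (inj₂ p)
            ; (inj₂ (inj₂ p)) → inj₂ (inj₁ p) })
         (λ { (inj₁ p) → irr p
            ; (inj₂ (inj₁ (p , q))) → i≢j (trans (sym p) q)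
            ; (inj₂ (inj₂ (p , q))) → i≢j (trans (sym p) q) })
         f
  = e′ , realises-resp
      (λ u v → mk⇔ (λ { (inj₁ a) → inj₁ (inj₁ a)
                      ; (inj₂ (inj₁ s)) → inj₂ s
                      ; (inj₂ (inj₂ c)) → inj₁ (inj₂ c) })
                   (λ { (inj₁ (inj₁ a)) → inj₁ a
                      ; (inj₁ (inj₂ c)) → inj₂ (inj₂ c)
                      ; (inj₂ s) → inj₂ (inj₁ s) }))
      (λ _ → refl) r
slicken (ρ i j e) _∼?_ ∼-sym irr f =
  slicken e (λ a b → rename i j a ∼? rename i j b) ∼-sym irr (f ∘ rename i j)
slicken (e₁ ⊕ e₂) _∼?_ ∼-sym irr f
  -- Both sides are built with `id`, since the join must read the original labels to decide `∼`; `f`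
  -- is applied afterwards, as `L` and `R`. Handing `∼` down supplies the pending edges within each
  -- side.
  with e₁′ , r₁ ← slicken e₁ _∼?_ ∼-sym irr id
     | e₂′ , r₂ ← slicken e₂ _∼?_ ∼-sym irr id
  = ⊕[ (λ a b → ⌊ a ∼? b ⌋) , f , f ] e₁′ e₂′ , realises-resp
      (λ { (inj₁ u) (inj₁ v) → ⇔-id _
         ; (inj₁ u) (inj₂ v) → mk⇔ (inj₂ ∘ toWitness) [ (λ ()) , fromWitness ]
         ; (inj₂ u) (inj₁ v) → mk⇔ (inj₂ ∘ ∼-sym ∘ toWitness)
                                   [ (λ ()) , fromWitness ∘ ∼-sym ]
         ; (inj₂ u) (inj₂ v) → ⇔-id _ })
      (λ { (inj₁ _) → refl ; (inj₂ _) → refl })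
      (realises-slickJoin _ f f r₁ r₂)

generated⇒slickGenerated : ∀ {K} → GeneratedBy K k → SlickGeneratedBy K k
generated⇒slickGenerated (e , i)
  with e′ , r ← slicken e {λ _ _ → ⊥} (λ _ _ → no λ ()) (λ ()) (λ ()) id
  = e′ , realises⇒≅ {H = ⟦ e ⟧}
      (realises-resp (λ _ _ → mk⇔ [ id , (λ ()) ] inj₁) (λ _ → refl) r) i

-- Injective relabelling

rename-source : (i j : Fin k) → rename i j i ≡ j
rename-source i j with i ≟ i
... | yes _  = refl
... | no i≢i = contradiction refl i≢i

rename-other : (i j : Fin k) {l : Fin k} → l ≢ i → rename i j l ≡ l
rename-other i j {l} l≢i with l ≟ i
... | yes l≡i = contradiction l≡i l≢i
... | no _    = refl

rename-natural : {σ : Fin m → Fin n} → Injective _≡_ _≡_ σ →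
                 ∀ i j l → rename (σ i) (σ j) (σ l) ≡ σ (rename i j l)
rename-natural {σ = σ} inj i j l with l ≟ i
... | yes refl = rename-source (σ i) (σ j)
... | no l≢i   = rename-other (σ i) (σ j) (l≢i ∘ inj)

connects-natural : {σ : Fin m → Fin n} → Injective _≡_ _≡_ σ →
                   ∀ i j a b → Connects (σ i) (σ j) (σ a) (σ b) ⇔ Connects i j a b
connects-natural {σ = σ} inj i j a b =
  mk⇔ inj² cong² ⊎-⇔ mk⇔ inj² cong²
  where
  inj² : ∀ {x y} → σ x ≡ σ i × σ y ≡ σ j → x ≡ i × y ≡ j
  inj² (p , q) = inj p , inj q

  cong² : ∀ {x y} → x ≡ i × y ≡ j → σ x ≡ σ i × σ y ≡ σ j
  cong² (p , q) = cong σ p , cong σ q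

-- Injectivity keeps the two labels of each `η` distinct and ensures that the translated `η` and `ρ`
-- act on exactly the same vertices as before.
relabel-injective : {σ : Fin m → Fin n} → Injective _≡_ _≡_ σ → (e : Expr m) →
  ∃[ e′ ] Realises ⟦ e′ ⟧ (LabelledGraph.Adj ⟦ e ⟧) (σ ∘ LabelledGraph.label ⟦ e ⟧)
relabel-injective {σ = σ} inj (atom i) = atom (σ i) , realises-self
relabel-injective {σ = σ} inj (η i j i≢j e) with e′ , r ← relabel-injective inj e =
  η (σ i) (σ j) (i≢j ∘ inj) e′ ,
  realises-resp (λ u v → ⇔-id _ ⊎-⇔ connects-natural inj i j _ _) (λ _ → refl)
    (realises-addEdges (i≢j ∘ inj) r)
relabel-injective {σ = σ} inj (ρ i j e) with e′ , r ← relabel-injective inj e =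
  ρ (σ i) (σ j) e′ ,
  realises-resp (λ _ _ → ⇔-id _) (λ _ → rename-natural inj i j _)
    (realises-mapLabels (rename (σ i) (σ j)) r)
relabel-injective inj (e₁ ⊕ e₂)
  with e₁′ , r₁ ← relabel-injective inj e₁
     | e₂′ , r₂ ← relabel-injective inj e₂
  = e₁′ ⊕ e₂′ , realises-resp
      (λ { (inj₁ _) (inj₁ _) → ⇔-id _
         ; (inj₁ _) (inj₂ _) → ⇔-id _
         ; (inj₂ _) (inj₁ _) → ⇔-id _
         ; (inj₂ _) (inj₂ _) → ⇔-id _ })
      (λ { (inj₁ _) → refl ; (inj₂ _) → refl })
      -- `_⊕_` is the slick join with no label pairs and identity relabellings.
      (realises-slickJoin (λ _ _ → false) id id r₁ r₂)

-- Arbitrary relabelling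

InjectiveBelow : ℕ → (Fin n → Fin k) → Set
InjectiveBelow m g = ∀ {x y} → toℕ x < m → toℕ y < m → g x ≡ g y → x ≡ y

-- Pigeonhole: if all `n` values were taken below `m`, a choice of preimages would embed `Fin n`
-- into `Fin m`.
fresh-value : (g : Fin n → Fin n) → m < n → ∃[ w ] (∀ u → toℕ u < m → g u ≢ w)
fresh-value {n} {m} g m<n =
  let w , w∉ = ¬∀⟶∃¬ n Hit (λ w → any? λ u → (toℕ u <? m) ×-dec (g u ≟ w)) ¬allHit
  in  w , λ u u<m gu≡w → w∉ (u , u<m , gu≡w)
  where
  Hit : Fin n → Set
  Hit w = ∃[ u ] (toℕ u < m × g u ≡ w)

  ¬allHit : ¬ (∀ w → Hit w)
  ¬allHit hit = <⇒≱ m<n (injective⇒≤ {f = index} index-injective)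
    where
    index : Fin n → Fin m
    index w = fromℕ< (proj₁ (proj₂ (hit w)))

    index-injective : Injective _≡_ _≡_ index
    index-injective {v} {w} eq = begin
      v                ≡⟨ proj₂ (proj₂ (hit v)) ⟨
      g (proj₁ (hit v)) ≡⟨ cong g (toℕ-injective (fromℕ<-injective _ _ _ _ eq)) ⟩
      g (proj₁ (hit w)) ≡⟨ proj₂ (proj₂ (hit w)) ⟩
      w                ∎
      where open ≡-Reasoning

injectiveBelow-suc : {g : Fin n → Fin k} {x : Fin n} → InjectiveBelow (toℕ x) g →
                     (∀ y → toℕ y < toℕ x → g y ≢ g x) → InjectiveBelow (suc (toℕ x)) g
injectiveBelow-suc inj new {y} {z} y<sx z<sx eq
  with m<1+n⇒m<n∨m≡n y<sx | m<1+n⇒m<n∨m≡n z<sx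
... | inj₁ y<x | inj₁ z<x = inj y<x z<x eq
... | inj₁ y<x | inj₂ z≡x with refl ← toℕ-injective z≡x = contradiction eq (new _ y<x)
... | inj₂ y≡x | inj₁ z<x with refl ← toℕ-injective y≡x = contradiction (sym eq) (new _ z<x)
... | inj₂ y≡x | inj₂ z≡x = toℕ-injective (trans y≡x (sym z≡x))

reset-injectiveBelow : {g : Fin n → Fin k} {x : Fin n} {w : Fin k} →
  InjectiveBelow (toℕ x) g → (∀ u → toℕ u < toℕ x → g u ≢ w) →
  InjectiveBelow (suc (toℕ x)) (updateAt g x (const w))
reset-injectiveBelow {g = g} {x} {w} inj fresh = injectiveBelow-suc
  (λ {y} {z} y<x z<x eq → inj y<x z<x (trans (sym (below y<x)) (trans eq (below z<x))))
  (λ y y<x eq → fresh y y<x (trans (sym (below y<x)) (trans eq (updateAt-updates x g))))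
  where
  below : ∀ {y} → toℕ y < toℕ x → updateAt g x (const w) y ≡ g y
  below {y} y<x = updateAt-minimal y x g λ { refl → <-irrefl refl y<x }

-- As `y` differs from `x`, the image of `rename x y` avoids `x`, so the new value there is never
-- read.
reset-rename : (g : Fin n → Fin n) {x y w : Fin n} → y ≢ x → g y ≡ g x →
               updateAt g x (const w) ∘ rename x y ≗ g
reset-rename g {x} {y} y≢x gy≡gx l with l ≟ x
... | yes refl = trans (updateAt-minimal y x g y≢x) gy≡gx
... | no l≢x   = updateAt-minimal l x g l≢x

-- If g merges x with a smaller y, then renaming x to y frees the value at x,
-- which can be reset to one that g does not take below x.
relabel-below : ∀ d m → d + m ≡ n → (g : Fin n → Fin n) → InjectiveBelow m g → (e : Expr n) →
  ∃[ e′ ] Realises ⟦ e′ ⟧ (LabelledGraph.Adj ⟦ e ⟧) (g ∘ LabelledGraph.label ⟦ e ⟧)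
-- Here `m` is `n`, so `g` is injective on all labels.
relabel-below zero _ refl g inj e =
  relabel-injective (λ {x} {y} → inj (toℕ<n x) (toℕ<n y)) e
relabel-below {n} (suc d) m eq g inj e with fromℕ< m<n | toℕ-fromℕ< m<n
  where
  m<n : m < n
  m<n = subst (m <_) eq (s≤s (m≤n+m m d))
... | x | refl with any? (λ y → (toℕ y <? toℕ x) ×-dec (g y ≟ g x))
... | no new =
  relabel-below d (suc (toℕ x)) (trans (+-suc d _) eq) g
    (injectiveBelow-suc inj λ y y<x gy≡gx → new (y , y<x , gy≡gx)) e
... | yes (y , y<x , gy≡gx)
  with w , fresh ← fresh-value g (toℕ<n x)
  -- The expression grows by a `ρ`; the recursion descends on `d`, the number of labels not yet
  -- examined.
  with e′ , r ← relabel-below d (suc (toℕ x)) (trans (+-suc d _) eq)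
                  (updateAt g x (const w)) (reset-injectiveBelow inj fresh) (ρ x y e)
  = e′ , realises-resp (λ _ _ → ⇔-id _)
           (λ _ → reset-rename g (λ { refl → <-irrefl refl y<x }) gy≡gx _) r

relabel : (g : Fin n → Fin n) (e : Expr n) → Realises ⟦ e ⟧ _~_ lab →
          ∃[ e′ ] Realises ⟦ e′ ⟧ _~_ (g ∘ lab)
relabel {n} g e r
  with e′ , s ← relabel-below n 0 (+-identityʳ n) g (λ ()) e
  = e′ , realises-trans {H = ⟦ e ⟧} g s r

-- From slick expressions to expressions

-- The pairs form a list because `addCrossing` spends one `η` on each entry. The first component is
-- read in the left copy of the labels, the second in the right copy.
Crossing : (ps : List (Fin k × Fin k)) (a b : Fin (k + k)) → Set
Crossing {k} ps a b = ∃[ i ] ∃[ j ] ((i , j) ∈ ps × Connects (i ↑ˡ k) (k ↑ʳ j) a b)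

↑ˡ≢↑ʳ : (i j : Fin k) → i ↑ˡ k ≢ k ↑ʳ j
↑ˡ≢↑ʳ {k} i j eq
  with () ← trans (sym (splitAt-↑ˡ k i k)) (trans (cong (splitAt k) eq) (splitAt-↑ʳ k k j))

-- `η` leaves labels unchanged, so the edges of successive pairs accumulate without interfering.
addCrossing : (ps : List (Fin k × Fin k)) (e : Expr (k + k)) →
  Realises ⟦ e ⟧ _~_ lab →
  ∃[ e′ ] Realises ⟦ e′ ⟧ (λ u v → (u ~ v) ⊎ Crossing ps (lab u) (lab v)) lab
addCrossing [] e r = e , realises-resp
  (λ _ _ → mk⇔ inj₁ λ { (inj₁ a) → a ; (inj₂ (_ , _ , () , _)) }) (λ _ → refl) r
addCrossing ((i , j) ∷ ps) e r with e′ , s ← addCrossing ps e r =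
  η (i ↑ˡ _) (_ ↑ʳ j) (↑ˡ≢↑ʳ i j) e′ , realises-resp
    (λ _ _ → mk⇔
      (λ { (inj₁ (inj₁ a)) → inj₁ a
         ; (inj₁ (inj₂ (i , j , p , c))) → inj₂ (i , j , there p , c)
         ; (inj₂ c) → inj₂ (_ , _ , here refl , c) })
      (λ { (inj₁ a) → inj₁ (inj₁ a)
         ; (inj₂ (_ , _ , here refl , c)) → inj₂ c
         ; (inj₂ (i , j , there p , c)) → inj₁ (inj₂ (i , j , p , c)) }))
    (λ _ → refl)
    (realises-addEdges (↑ˡ≢↑ʳ i j) s)

pairs : (Fin k → Fin k → Bool) → List (Fin k × Fin k)
pairs S = filter (λ (i , j) → T? (S i j)) (cartesianProduct (allFin _) (allFin _))

module _ (S : Fin k → Fin k → Bool) where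

  crossing-↑ˡ↑ʳ : ∀ a b → T (S a b) ⇔ Crossing (pairs S) (a ↑ˡ k) (k ↑ʳ b)
  crossing-↑ˡ↑ʳ a b = mk⇔
    (λ s → a , b ,
      ∈-filter⁺ _ (∈-cartesianProduct⁺ (∈-allFin a) (∈-allFin b)) s , inj₁ (refl , refl))
    λ { (i , j , p , inj₁ (q , q′)) →
          subst₂ (λ i j → T (S i j))
            (sym (↑ˡ-injective k _ _ q)) (sym (↑ʳ-injective k _ _ q′))
            (proj₂ (∈-filter⁻ (λ (i , j) → T? (S i j))
              {xs = cartesianProduct (allFin k) (allFin k)} p))
      -- The reversed orientation would identify a right label with a left one.
      ; (i , j , p , inj₂ (q , _)) → contradiction (sym q) (↑ˡ≢↑ʳ i b) }

  ¬crossing-↑ˡ↑ˡ : ∀ a b → ¬ Crossing (pairs S) (a ↑ˡ k) (b ↑ˡ k)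
  ¬crossing-↑ˡ↑ˡ a b (_ , j , _ , inj₁ (_ , q)) = ↑ˡ≢↑ʳ b j q
  ¬crossing-↑ˡ↑ˡ a b (_ , j , _ , inj₂ (_ , q)) = ↑ˡ≢↑ʳ a j q

  ¬crossing-↑ʳ↑ʳ : ∀ a b → ¬ Crossing (pairs S) (k ↑ʳ a) (k ↑ʳ b)
  ¬crossing-↑ʳ↑ʳ a b (i , _ , _ , inj₁ (q , _)) = ↑ˡ≢↑ʳ i a (sym q)
  ¬crossing-↑ʳ↑ʳ a b (i , _ , _ , inj₂ (q , _)) = ↑ˡ≢↑ʳ i b (sym q)

crossing-sym : ∀ {ps : List (Fin k × Fin k)} {a b} → Crossing ps a b → Crossing ps b a
crossing-sym (i , j , p , c) = i , j , p , swap c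

-- The invariant is that every label lies in the left copy, which leaves the right copy free for the
-- second operand of the next join.
unslick : (e : SlickExpr k) → let open LabelledGraph ⟦ e ⟧ˢ in
          ∃[ e′ ] Realises {k = k + k} ⟦ e′ ⟧ Adj ((_↑ˡ k) ∘ label)
unslick {k} (atom i) = atom (i ↑ˡ k) , record
  { bijection = ↔-id _ ; preserves = λ _ _ → ⇔-id _ ; labels = λ _ → refl }
unslick {k} (⊕[ S , L , R ] e₁ e₂)
  with e₁′ , r₁ ← unslick e₁
     | e₂′ , r₂ ← unslick e₂
  -- `relabel` takes a self-map of all `k + k` labels; this one sends both copies to the right copy.
  with e₂″ , r₂′ ← relabel ([ k ↑ʳ_ , k ↑ʳ_ ] ∘ splitAt k) e₂′ r₂
  with e , r ← addCrossing (pairs S) (e₁′ ⊕ e₂″)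
                 (realises-slickJoin (λ _ _ → false) id id r₁
                   (realises-resp (λ _ _ → ⇔-id _)
                     (λ _ → cong [ _ , _ ] (splitAt-↑ˡ k _ k)) r₂′))
  -- The copy a label lies in tells its side, so a single map applies `L` and `R` at once and
  -- restores the invariant.
  with e′ , r′ ← relabel ([ (_↑ˡ k) ∘ L , (_↑ˡ k) ∘ R ] ∘ splitAt k) e r
  = e′ , realises-resp
      (λ { (inj₁ _) (inj₁ _) → mk⇔ [ id , (λ c → contradiction c (¬crossing-↑ˡ↑ˡ S _ _)) ] inj₁
         ; (inj₁ _) (inj₂ _) → mk⇔ [ (λ ()) , from (crossing-↑ˡ↑ʳ S _ _) ]
                                   (inj₂ ∘ to (crossing-↑ˡ↑ʳ S _ _))
         ; (inj₂ _) (inj₁ _) → mk⇔ [ (λ ()) , from (crossing-↑ˡ↑ʳ S _ _) ∘ crossing-sym ]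
                                   (inj₂ ∘ crossing-sym ∘ to (crossing-↑ˡ↑ʳ S _ _))
         ; (inj₂ _) (inj₂ _) → mk⇔ [ id , (λ c → contradiction c (¬crossing-↑ʳ↑ʳ S _ _)) ] inj₁ })
      (λ { (inj₁ _) → cong [ _ , _ ] (splitAt-↑ˡ k _ k)
         ; (inj₂ _) → cong [ _ , _ ] (splitAt-↑ʳ k k _) })
      r′
  where open Equivalence

slickGenerated⇒generated : ∀ {K} → SlickGeneratedBy K k → GeneratedBy K (2 * k)
slickGenerated⇒generated {k} {K} (e , i) with e′ , r ← unslick e =
  -- `2 * k` unfolds to `k + (k + 0)`.
  subst (λ l → GeneratedBy K (k + l)) (sym (+-identityʳ k))
    (e′ , realises⇒≅ {H = ⟦ e ⟧ˢ} r i)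

theorem1 : (G : Graph) (cw scw : ℕ) →
    IsCliqueWidth G cw → IsSlickCliqueWidth G scw →
    (scw ≤ cw) × (cw ≤ 2 * scw)
theorem1 G cw scw (gen , cw-least) (slick , scw-least) =
  scw-least cw (generated⇒slickGenerated gen) ,
  cw-least (2 * scw) (slickGenerated⇒generated slick)
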